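{- For each positive integer $k$, there exists an oriented graph $G$ with $\delta^0(G) = \bar{\delta}^0(G) = k$ that contains neither an antipath of length $2k$ nor an anticycle of length $2k$.
   Context: An oriented graph is a loopless directed graph without cycles of length $2$ (that is, for any two distinct vertices $u,v$, at most one of $uv$ and $vu$ is an edge). The minimum semidegree $\delta^0(G)$ of a digraph $G$ is the minimum value amongst the in-degrees and out-degrees of all its vertices. The minimum pseudo-semidegree $\bar{\delta}^0(G)$ of a digraph $G$ with at least one edge is the minimum value amongst all non-zero in-degrees and non-zero out-degrees of its vertices; if $G$ has no edges, then $\bar{\delta}^0(G)=0$. An antipath is an oriented path (an orientation of a path with distinct vertices) in which each vertex has in-degree $0$ or out-degree $0$ within the path. An anticycle is an oriented cycle (necessarily of even length) in which each vertex has in-degree $0$ or out-degree $0$ within the cycle. The length of a path or cycle is its number of edges. "Contains" means as a (not necessarily induced) subgraph. -}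

module Defs where

open import Data.Fin using (Fin; toℕ)
open import Data.List using (List; []; _∷_; _++_; length; map; filter; allFin)
open import Data.List.Extrema.Nat using (min)
open import Data.Nat using (ℕ; suc; _≤_; _≟_)
open import Data.Product using (Σ-syntax; _×_)
open import Data.Sum using (_⊎_)
open import Function using (_∘_; _⇔_)
open import Function.Definitions using (Injective)
open import Level using (0ℓ)
open import Relation.Binary using (Rel; Decidable; Irreflexive; Asymmetric)
open import Relation.Binary.PropositionalEquality using (_≡_)
open import Relation.Nullary.Decidable using (¬?)

-- Adjacency is decidable so that degrees can be counted constructively.
record Digraph (n : ℕ) : Set₁ where
  field
    _⟶_  : Rel (Fin n) 0ℓ
    _⟶?_ : Decidable _⟶_

  outDegree : Fin n → ℕ
  outDegree v = length (filter (λ w → v ⟶? w) (allFin n))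

  inDegree : Fin n → ℕ
  inDegree v = length (filter (λ w → w ⟶? v) (allFin n))

  semidegrees : List ℕ
  semidegrees = map inDegree (allFin n) ++ map outDegree (allFin n)

record IsOriented {n : ℕ} (G : Digraph n) : Set where
  open Digraph G
  field
    loopless  : Irreflexive _≡_ _⟶_
    no2Cycles : Asymmetric _⟶_

-- The value 0 on the empty list is the convention for the pseudo-semidegree
-- of an edgeless digraph; for the semidegree it only concerns the digraph
-- with no vertices.
minimum : List ℕ → ℕ
minimum []       = 0
minimum (d ∷ ds) = min d ds

δ⁰ : ∀ {n} → Digraph n → ℕ
δ⁰ G = minimum (Digraph.semidegrees G)

δ̄⁰ : ∀ {n} → Digraph n → ℕ
δ̄⁰ G = minimum (filter (¬? ∘ (_≟ 0)) (Digraph.semidegrees G))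

_Contains_ : ∀ {m n} → Digraph n → Digraph m → Set
_Contains_ {m} {n} G H =
  Σ[ f ∈ (Fin m → Fin n) ]
    Injective _≡_ _≡_ f × (∀ {u v} → Digraph._⟶_ H u v → Digraph._⟶_ G (f u) (f v))

record IsOrientationOf {n : ℕ} (D : Digraph n) (_~_ : Rel (Fin n) 0ℓ) : Set where
  open Digraph D
  field
    isOriented : IsOriented D
    underlying : ∀ u v → (u ⟶ v ⊎ v ⟶ u) ⇔ (u ~ v)

PathAdjacent : ∀ {n} → Rel (Fin n) 0ℓ
PathAdjacent i j = toℕ j ≡ suc (toℕ i) ⊎ toℕ i ≡ suc (toℕ j)

CyclicSuccessor : ∀ {n} → Rel (Fin n) 0ℓ
CyclicSuccessor {n} i j = toℕ j ≡ suc (toℕ i) ⊎ (suc (toℕ i) ≡ n × toℕ j ≡ 0)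

CycleAdjacent : ∀ {n} → Rel (Fin n) 0ℓ
CycleAdjacent i j = CyclicSuccessor i j ⊎ CyclicSuccessor j i

Antidirected : ∀ {n} → Digraph n → Set
Antidirected D = ∀ v → inDegree v ≡ 0 ⊎ outDegree v ≡ 0
  where open Digraph D

-- A path of length ℓ has ℓ + 1 vertices.
record IsAntipath (ℓ : ℕ) (P : Digraph (suc ℓ)) : Set where
  field
    isOrientedPath : IsOrientationOf P PathAdjacent
    antidirected   : Antidirected P

-- For fewer than three vertices CycleAdjacent does not describe a cycle
-- (on two vertices it is a single edge), hence the lower bound.
record IsAnticycle (ℓ : ℕ) (C : Digraph ℓ) : Set where
  field
    3≤ℓ             : 3 ≤ ℓ
    isOrientedCycle : IsOrientationOf C CycleAdjacent
    antidirected    : Antidirected C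

ContainsAntipath : ∀ {n} → Digraph n → ℕ → Set₁
ContainsAntipath G ℓ = Σ[ P ∈ Digraph (suc ℓ) ] IsAntipath ℓ P × G Contains P

ContainsAnticycle : ∀ {n} → Digraph n → ℕ → Set₁
ContainsAnticycle G ℓ = Σ[ C ∈ Digraph ℓ ] IsAnticycle ℓ C × G Contains C

{-# OPTIONS --safe #-}

-- For k ≥ 3 take independent sets A₀, A₁ of size k − 1 and directed k-cycles
-- Z₀, Z₁, joined completely as A₀ → Z₀ → A₁ → Z₁ → A₀; all degrees are k.
-- Along an antipath or anticycle only one Zᵢ occurs, and no two consecutive
-- vertices lie in A₀ ∪ A₁.  Suppose that an antipath on 2k vertices starts in
-- Zᵢ.  If it alternates between Zᵢ and A₀ ∪ A₁, then it meets a single Aⱼ in k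
-- vertices; otherwise it meets Zᵢ in k + 1 vertices.  Both are impossible, so it
-- starts in A₀ ∪ A₁.  An antipath or an anticycle of length 2k contains two such
-- antipaths with adjacent starting vertices, which is absurd.
-- For k = 1 and k = 2 the circulant graphs C₃(1) and C₅(1, 2) work.
module Submission where

open import Data.Bool using (Bool; true; false; not)
import Data.Bool as Bool
open import Data.Bool.Properties using (not-involutive; not-¬)
open import Data.Fin using (Fin; zero; suc; fromℕ; inject₁; toℕ)
open import Data.Fin.Properties
  using (_≟_; all?; toℕ-fromℕ; toℕ-inject₁; fromℕ≢inject₁; inject₁-injective;
         suc-injective; injective⇒≤; 2↔Bool; *↔×; +↔⊎)
open import Data.Fin.Relation.Unary.Top using (view; ‵fromℕ; ‵inject₁)
open import Data.List
  using (List; []; _∷_; length; map; filter; allFin; tabulate; lookup)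
open import Data.List.Extrema.Nat using (min≤⊤; v≤min⁺)
open import Data.List.Membership.Propositional using (_∈_; lose)
open import Data.List.Membership.Propositional.Properties
  using (∈-lookup; ∈-allFin; ∈-map⁺; ∈-map⁻; ∈-++⁺ˡ; ∈-filter⁺; ∈-filter⁻)
open import Data.List.Properties
  using (length-map; length-tabulate; filter-all; filter-some)
open import Data.List.Relation.Binary.Subset.Propositional using (_⊆_)
open import Data.List.Relation.Unary.All as All using (All; []; _∷_)
import Data.List.Relation.Unary.All.Properties as All
open import Data.List.Relation.Unary.AllPairs using (AllPairs; []; _∷_)
import Data.List.Relation.Unary.AllPairs.Properties as AllPairs
open import Data.List.Relation.Unary.Any using (here; there; index)
open import Data.List.Relation.Unary.Any.Properties using (lookup-index)
open import Data.List.Relation.Unary.Linked as Linked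
  using (Linked; []; [-]; _∷_)
open import Data.List.Relation.Unary.Linked.Properties using (Linked⇒All)
open import Data.List.Relation.Unary.Unique.Propositional using (Unique)
import Data.List.Relation.Unary.Unique.Propositional.Properties as Unique
open import Data.Nat using (ℕ; zero; suc; _+_; _≥_; _*_; _≤_; z≤n; s≤s)
open import Data.Nat.Properties as ℕ
  using (≤-trans; ≤-reflexive; ≤-antisym; *-comm; 1+n≰n)
open import Data.Product using (Σ-syntax; ∃-syntax; _×_; _,_; proj₂; map₂)
open import Data.Product.Function.NonDependent.Propositional using (_×-↔_)
open import Data.Product.Properties using (,-injectiveʳ)
open import Data.Sum as Sum using (_⊎_; inj₁; inj₂; [_,_]′)
open import Data.Sum.Properties using (inj₁-injective; inj₂-injective)
open import Data.Unit using (⊤; tt)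
open import Data.Empty using (⊥)
open import Function using (_∘_; _on_; flip; _↔_; Equivalence; Inverse; case_of_)
open import Function.Construct.Composition using (_↔-∘_)
open import Function.Definitions using (Injective)
open import Level using (0ℓ)
open import Relation.Binary using (Rel; Decidable)
open import Relation.Binary.PropositionalEquality
  using (_≡_; _≢_; refl; sym; trans; cong; subst; module ≡-Reasoning)
open import Relation.Nullary using (¬_; Dec; yes; no; contradiction)
open import Relation.Nullary.Decidable
  using (¬?; _×-dec_; _⊎-dec_; _→-dec_; from-yes)
import Relation.Unary as U
open import Defs

private
  variable
    A B : Set
    n : ℕ

-- Counting with duplicate-free lists

lookup-injective : {xs : List A} → Unique xs → Injective _≡_ _≡_ (lookup xs)
lookup-injective (_ ∷ _) {zero}  {zero}  _  = refl
lookup-injective (x≢ ∷ _) {zero}  {suc j} eq =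
  contradiction eq (All.lookup x≢ (∈-lookup j))
lookup-injective (x≢ ∷ _) {suc i} {zero}  eq =
  contradiction (sym eq) (All.lookup x≢ (∈-lookup i))
lookup-injective (_ ∷ u) {suc i} {suc j} eq = cong suc (lookup-injective u eq)

-- Pigeonhole: each position of `xs` is sent to a position of the same element in `ys`, and
-- `Unique xs` makes this map of positions injective.
unique-⊆⇒length≤ : {xs ys : List A} → Unique xs → xs ⊆ ys → length xs ≤ length ys
unique-⊆⇒length≤ {xs = xs} {ys} u xs⊆ys = injective⇒≤ {f = position} inj
  where
  position : Fin (length xs) → Fin (length ys)
  position i = index (xs⊆ys (∈-lookup i))

  inj : Injective _≡_ _≡_ position
  inj {i} {j} eq = lookup-injective u (begin
    lookup xs i             ≡⟨ lookup-index (xs⊆ys (∈-lookup i)) ⟩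
    lookup ys (position i)  ≡⟨ cong (lookup ys) eq ⟩
    lookup ys (position j)  ≡⟨ lookup-index (xs⊆ys (∈-lookup j)) ⟨
    lookup xs j             ∎)
    where open ≡-Reasoning

length-allFin : ∀ n → length (allFin n) ≡ n
length-allFin n = length-tabulate {n = n} (λ i → i)

length-map-allFin : (f : Fin n → A) → length (map f (allFin n)) ≡ n
length-map-allFin {n} f = trans (length-map f (allFin n)) (length-allFin n)

module _ (iso : Fin n ↔ A) where
  open Inverse iso

  to-injective : Injective _≡_ _≡_ to
  to-injective {i} {j} eq =
    trans (sym (strictlyInverseʳ i)) (trans (cong from eq) (strictlyInverseʳ j))

  -- Transfers degree counts from `Fin n` to the structured type `A`. Each of two duplicate-free
  -- lists is contained in the other, so the lengths agree.
  length-filter-allFin : {P : A → Set} (P? : U.Decidable P) {zs : List A} →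
    Unique zs → (∀ {v} → P v → v ∈ zs) → (∀ {v} → v ∈ zs → P v) →
    length (filter (P? ∘ to) (allFin n)) ≡ length zs
  length-filter-allFin {P} P? {zs} u P⇒∈ ∈⇒P = trans (sym (length-map to selected))
    (≤-antisym
      (unique-⊆⇒length≤
        (Unique.map⁺ to-injective (Unique.filter⁺ (P? ∘ to) (Unique.allFin⁺ n))) left)
      (unique-⊆⇒length≤ u right))
    where
    selected = filter (P? ∘ to) (allFin n)

    left : map to selected ⊆ zs
    left v∈ with ∈-map⁻ to v∈
    ... | i , i∈ , refl = P⇒∈ (proj₂ (∈-filter⁻ (P? ∘ to) {xs = allFin n} i∈))

    right : zs ⊆ map to selected
    right {v} v∈ = subst (_∈ map to selected) (strictlyInverseˡ v)
      (∈-map⁺ to (∈-filter⁺ (P? ∘ to) (∈-allFin (from v))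
        (subst P (sym (strictlyInverseˡ v)) (∈⇒P v∈))))

linked-tabulate : ∀ {l} {R : Rel A 0ℓ} (h : Fin (suc l) → A) →
  (∀ i → R (h (inject₁ i)) (h (suc i))) → Linked R (tabulate h)
linked-tabulate {l = zero}  h r = [-]
linked-tabulate {l = suc l} h r = r zero ∷ linked-tabulate (h ∘ suc) (r ∘ suc)

-- Minimum semidegrees of regular digraphs

-- The member `x` rules out the empty list, where `minimum` would be 0 instead of `k`.
minimum-constant : ∀ {k x} {xs : List ℕ} → x ∈ xs → All (_≡ k) xs → minimum xs ≡ k
minimum-constant {xs = d ∷ ds} _ (refl ∷ ds≡k) = ≤-antisym (min≤⊤ d ds)
  (v≤min⁺ ℕ.≤-refl (All.map (≤-reflexive ∘ sym) ds≡k))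

module _ (G : Digraph n) where
  open Digraph G

  module _ {k} (v : Fin n) (in≡k : ∀ u → inDegree u ≡ k) (out≡k : ∀ u → outDegree u ≡ k) where

    private
      all≡k : All (_≡ k) semidegrees
      all≡k = All.++⁺ (All.map⁺ (All.universal in≡k (allFin n)))
                      (All.map⁺ (All.universal out≡k (allFin n)))

      nonempty : inDegree v ∈ semidegrees
      nonempty = ∈-++⁺ˡ (∈-map⁺ inDegree (∈-allFin v))

    regular⇒δ⁰ : δ⁰ G ≡ k
    regular⇒δ⁰ = minimum-constant nonempty all≡k

    regular⇒δ̄⁰ : k ≢ 0 → δ̄⁰ G ≡ k
    regular⇒δ̄⁰ k≢0 = trans
      (cong minimum (filter-all (¬? ∘ (ℕ._≟ 0)) (All.map (λ { refl → k≢0 }) all≡k)))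
      regular⇒δ⁰

  outDegree≢0 : ∀ {u v} → u ⟶ v → outDegree u ≢ 0
  outDegree≢0 {u} {v} e = ℕ.>⇒≢ (filter-some (u ⟶?_) (lose (∈-allFin v) e))

  inDegree≢0 : ∀ {u v} → u ⟶ v → inDegree v ≢ 0
  inDegree≢0 {u} {v} e = ℕ.>⇒≢ (filter-some (_⟶? v) (lose (∈-allFin u) e))

-- Cyclic predecessor

-- Unrolls a cycle into a closed walk that starts and ends at its last vertex. Without its first
-- entry the walk is the identity; without its last entry it is `prev`.
wrap : Fin (suc (suc n)) → Fin (suc n)
wrap zero    = fromℕ _
wrap (suc i) = i

prev : Fin n → Fin n
prev zero    = fromℕ _
prev (suc i) = inject₁ i

next : Fin n → Fin n
next i with view i
... | ‵fromℕ     = zero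
... | ‵inject₁ j = suc j

prev-next : (i : Fin n) → prev (next i) ≡ i
prev-next i with view i
... | ‵fromℕ     = refl
... | ‵inject₁ j = refl

prev-injective : Injective _≡_ _≡_ (prev {n})
prev-injective {x = zero}  {zero}  _  = refl
prev-injective {x = zero}  {suc j} eq = contradiction eq fromℕ≢inject₁
prev-injective {x = suc i} {zero}  eq = contradiction (sym eq) fromℕ≢inject₁
prev-injective {x = suc i} {suc j} eq = cong suc (inject₁-injective eq)

prev-prev≢ : (i : Fin (3 + n)) → prev (prev i) ≢ i
prev-prev≢ zero ()
prev-prev≢ (suc zero) ()
prev-prev≢ (suc (suc i)) eq = ℕ.<⇒≢ (s≤s (ℕ.n≤1+n (toℕ i)))
  (trans (sym (trans (toℕ-inject₁ (inject₁ i)) (toℕ-inject₁ i))) (cong toℕ eq))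

wrap-inject₁ : (i : Fin (suc n)) → wrap (inject₁ i) ≡ prev i
wrap-inject₁ zero            = refl
wrap-inject₁ {suc _} (suc i) = refl

prev-cyclicSuccessor : (i : Fin n) → CyclicSuccessor (prev i) i
prev-cyclicSuccessor zero    = inj₂ (cong suc (toℕ-fromℕ _) , refl)
prev-cyclicSuccessor (suc i) = inj₁ (cong suc (sym (toℕ-inject₁ i)))

-- Antiwalks

-- The sign of a vertex of an antidirected walk is true for sources.
data Step (R : Rel A 0ℓ) : Rel (Bool × A) 0ℓ where
  forward  : ∀ {u v} → R u v → Step R (true , u) (false , v)
  backward : ∀ {u v} → R v u → Step R (false , u) (true , v)

Step-map : {R : Rel A 0ℓ} {S : Rel B 0ℓ} (f : A → B) →
  (∀ {u v} → R u v → S (f u) (f v)) →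
  ∀ {p q} → Step R p q → Step S (map₂ f p) (map₂ f q)
Step-map f h (forward e)  = forward (h e)
Step-map f h (backward e) = backward (h e)

-- Both an antipath of length ℓ and an anticycle of length ℓ, traversed once
-- around, give an antiwalk.
record Antiwalk (R : Rel A 0ℓ) (ℓ : ℕ) : Set where
  field
    walk          : Fin (suc ℓ) → Bool × A
    step          : ∀ i → Step R (walk (inject₁ i)) (walk (suc i))
    initInjective : Injective _≡_ _≡_ (proj₂ ∘ walk ∘ inject₁)
    tailInjective : Injective _≡_ _≡_ (proj₂ ∘ walk ∘ suc)

Antiwalk-map : {R : Rel A 0ℓ} {S : Rel B 0ℓ} {f : A → B} → Injective _≡_ _≡_ f →
  (∀ {u v} → R u v → S (f u) (f v)) → ∀ {ℓ} → Antiwalk R ℓ → Antiwalk S ℓ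
Antiwalk-map {f = f} f-inj h w = record
  { walk          = map₂ f ∘ walk
  ; step          = Step-map f h ∘ step
  ; initInjective = initInjective ∘ f-inj
  ; tailInjective = tailInjective ∘ f-inj
  }
  where open Antiwalk w

module _ {m} {D : Digraph m} {_~_ : Rel (Fin m) 0ℓ}
         (orientation : IsOrientationOf D _~_) (anti : Antidirected D) where
  open Digraph D
  open IsOrientationOf orientation

  sign : Fin m → Bool
  sign v = [ (λ _ → true) , (λ _ → false) ]′ (anti v)

  -- The edge between `i` and `j` gives its tail a nonzero out-degree and its head a nonzero
  -- in-degree. Hence `anti` can only make the tail a source and the head a sink.
  sign-step : ∀ {i j} → i ~ j → Step _⟶_ (sign i , i) (sign j , j)
  sign-step {i} {j} i~j with anti i | anti j | Equivalence.from (underlying i j) i~j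
  ... | inj₁ _     | inj₂ _     | inj₁ e = forward e
  ... | inj₂ _     | inj₁ _     | inj₂ e = backward e
  ... | inj₂ out≡0 | _          | inj₁ e = contradiction out≡0 (outDegree≢0 D e)
  ... | inj₁ _     | inj₁ in≡0  | inj₁ e = contradiction in≡0 (inDegree≢0 D e)
  ... | inj₁ in≡0  | _          | inj₂ e = contradiction in≡0 (inDegree≢0 D e)
  ... | inj₂ _     | inj₂ out≡0 | inj₂ e = contradiction out≡0 (outDegree≢0 D e)

module _ (G : Digraph n) where
  open Digraph G

  -- Keeps injectivity on all vertices, which `Antiwalk` forgets. `C₃` needs it: an edge traversed
  -- forth and back is an antiwalk of length 2.
  antipath⇒walk : ∀ {ℓ} → ContainsAntipath G ℓ →
    Σ[ w ∈ (Fin (suc ℓ) → Bool × Fin n) ]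
      (∀ i → Step _⟶_ (w (inject₁ i)) (w (suc i))) × Injective _≡_ _≡_ (proj₂ ∘ w)
  antipath⇒walk (P , isP , f , f-inj , f-edge) =
      (λ i → sign isOrientedPath antidirected i , f i)
    , (λ i → Step-map f f-edge (sign-step isOrientedPath antidirected
               (inj₁ (cong suc (sym (toℕ-inject₁ i))))))
    , f-inj
    where open IsAntipath isP

  antipath⇒antiwalk : ∀ {ℓ} → ContainsAntipath G ℓ → Antiwalk _⟶_ ℓ
  antipath⇒antiwalk c with antipath⇒walk c
  ... | w , w-step , w-inj = record
    { walk          = w
    ; step          = w-step
    ; initInjective = inject₁-injective ∘ w-inj
    ; tailInjective = suc-injective ∘ w-inj
    }

  anticycle⇒antiwalk : ∀ {ℓ} → ContainsAnticycle G (suc ℓ) → Antiwalk _⟶_ (suc ℓ)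
  anticycle⇒antiwalk (C , isC , f , f-inj , f-edge) = record
    { walk          = w
    ; step          = λ i → Step-map f f-edge (sign-step isOrientedCycle antidirected (adjacent i))
    ; initInjective = λ {i} {j} eq → prev-injective
        (trans (sym (wrap-inject₁ i)) (trans (f-inj eq) (wrap-inject₁ j)))
    ; tailInjective = f-inj
    }
    where
    open IsAnticycle isC
    w = λ i → sign isOrientedCycle antidirected (wrap i) , f (wrap i)

    adjacent : ∀ i → CycleAdjacent (wrap (inject₁ i)) i
    adjacent i = inj₁ (subst (λ j → CyclicSuccessor j i) (sym (wrap-inject₁ i))
                             (prev-cyclicSuccessor i))

-- The small cases

C₃ : Digraph 3
C₃ = record { _⟶_ = λ u v → u ≡ prev v ; _⟶?_ = λ u v → u ≟ prev v }

prev-fixpointFree : {i : Fin (3 + n)} → i ≢ prev i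
prev-fixpointFree {i = i} eq = prev-prev≢ i (sym (trans eq (cong prev eq)))

C₃-oriented : IsOriented C₃
C₃-oriented = record
  { loopless  = λ { refl → prev-fixpointFree }
  ; no2Cycles = λ { {u} refl eq → prev-prev≢ _ (sym eq) }
  }

-- Every vertex of `C₃` has a single in-neighbour and a single out-neighbour, so two steps in
-- opposite directions use the same edge.
C₃-there-and-back : ∀ {p q r} → Step (Digraph._⟶_ C₃) p q → Step (Digraph._⟶_ C₃) q r →
  proj₂ p ≡ proj₂ r
C₃-there-and-back (forward refl)  (backward refl) = refl
C₃-there-and-back (backward refl) (forward eq)    = prev-injective eq

C₃-noAntipath : ¬ ContainsAntipath C₃ 2
C₃-noAntipath c with antipath⇒walk C₃ c
... | w , w-step , w-inj
  with () ← w-inj (C₃-there-and-back (w-step zero) (w-step (suc zero)))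

C₅ : Digraph 5
C₅ = record
  { _⟶_  = λ u v → u ≡ prev v ⊎ u ≡ prev (prev v)
  ; _⟶?_ = λ u v → (u ≟ prev v) ⊎-dec (u ≟ prev (prev v))
  }

C₅-oriented : IsOriented C₅
C₅-oriented = record
  { loopless  = λ { {u} refl → from-yes (all? λ v → ¬? (v ⟶? v)) u }
  ; no2Cycles = λ {u} {v} → from-yes (all? λ x → all? λ y → (x ⟶? y) →-dec ¬? (y ⟶? x)) u v
  }
  where open Digraph C₅

-- The endpoints v₀ and v₄ are allowed to coincide.
NoZigzag : Rel (Fin n) 0ℓ → Set
NoZigzag R = ∀ v₀ v₁ v₂ v₃ v₄ → R v₀ v₁ → R v₂ v₁ → R v₂ v₃ → R v₄ v₃ →
  v₀ ≢ v₂ → v₀ ≢ v₃ → v₁ ≢ v₃ → v₁ ≢ v₄ → v₂ ≢ v₄ → ⊥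

noZigzag? : {R : Rel (Fin n) 0ℓ} → Decidable R → Dec (NoZigzag R)
noZigzag? R? = all? λ v₀ → all? λ v₁ → all? λ v₂ → all? λ v₃ → all? λ v₄ →
  R? v₀ v₁ →-dec R? v₂ v₁ →-dec R? v₂ v₃ →-dec R? v₄ v₃ →-dec
  ¬? (v₀ ≟ v₂) →-dec ¬? (v₀ ≟ v₃) →-dec ¬? (v₁ ≟ v₃) →-dec
  ¬? (v₁ ≟ v₄) →-dec ¬? (v₂ ≟ v₄) →-dec no (λ ())

-- Two sinks with a common source x are x+1 and x+2 modulo 5, and the other in-neighbour of x+2 is
-- x+1. So a zigzag with x in the middle has `v₀ ≡ v₃` or `v₄ ≡ v₁`; the code checks this by
-- exhaustion.
C₅-noAntiwalk : ¬ Antiwalk (Digraph._⟶_ C₅) 4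
C₅-noAntiwalk w =
  noFive (step zero) (step (suc zero)) (step (suc (suc zero))) (step (suc (suc (suc zero))))
    (λ eq → case initInjective {zero} {suc (suc zero)} eq of λ ())
    (λ eq → case initInjective {zero} {suc (suc (suc zero))} eq of λ ())
    (λ eq → case initInjective {suc zero} {suc (suc (suc zero))} eq of λ ())
    (λ eq → case tailInjective {zero} {suc (suc (suc zero))} eq of λ ())
    (λ eq → case tailInjective {suc zero} {suc (suc (suc zero))} eq of λ ())
  where
  open Digraph C₅
  open Antiwalk w

  noFive : ∀ {p₀ p₁ p₂ p₃ p₄} →
    Step _⟶_ p₀ p₁ → Step _⟶_ p₁ p₂ → Step _⟶_ p₂ p₃ → Step _⟶_ p₃ p₄ →
    proj₂ p₀ ≢ proj₂ p₂ → proj₂ p₀ ≢ proj₂ p₃ → proj₂ p₁ ≢ proj₂ p₃ →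
    proj₂ p₁ ≢ proj₂ p₄ → proj₂ p₂ ≢ proj₂ p₄ → ⊥
  noFive (forward a) (backward b) (forward c) (backward d) =
    from-yes (noZigzag? _⟶?_) _ _ _ _ _ a b c d
  -- The opposite sign pattern is a zigzag of the reversed digraph.
  noFive (backward a) (forward b) (backward c) (forward d) =
    from-yes (noZigzag? (flip _⟶?_)) _ _ _ _ _ a b c d

-- The general case

module Blowup (m : ℕ) where

  -- (i , inj₁ a) is a vertex of Aᵢ and (i , inj₂ z) is a vertex of Zᵢ.
  V : Set
  V = Bool × (Fin m ⊎ Fin (suc m))

  pattern rim i a = i , inj₁ a
  pattern hub i z = i , inj₂ z

  -- All edges leaving Aᵢ or Zᵢ end in Zᵢ or in the other A-block.
  src tgt : V → Bool
  src (i , _)   = i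
  tgt (rim i _) = not i
  tgt (hub i _) = i

  Local : Rel (Fin m ⊎ Fin (suc m)) 0ℓ
  Local (inj₁ _) (inj₁ _) = ⊥
  Local (inj₁ _) (inj₂ _) = ⊤
  Local (inj₂ _) (inj₁ _) = ⊤
  Local (inj₂ z) (inj₂ w) = z ≡ prev w

  local? : Decidable Local
  local? (inj₁ _) (inj₁ _) = no λ ()
  local? (inj₁ _) (inj₂ _) = yes tt
  local? (inj₂ _) (inj₁ _) = yes tt
  local? (inj₂ z) (inj₂ w) = z ≟ prev w

  E : Rel V 0ℓ
  E u v = src u ≡ tgt v × Local (proj₂ u) (proj₂ v)

  E? : Decidable E
  E? u v = (src u Bool.≟ tgt v) ×-dec local? (proj₂ u) (proj₂ v)

  order : ℕ
  order = 2 * (m + suc m)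

  iso : Fin order ↔ V
  iso = (2↔Bool ×-↔ +↔⊎) ↔-∘ *↔×

  open Inverse iso using (to; from)

  G : Digraph order
  G = record { _⟶_ = E on to ; _⟶?_ = λ u v → E? (to u) (to v) }

  -- Neighbourhoods, regularity and orientation of the blow-up

  rims hubs : Bool → List V
  rims i = map (rim i) (allFin m)
  hubs i = map (hub i) (allFin (suc m))

  rims-unique : ∀ i → Unique (rims i)
  rims-unique i = Unique.map⁺ (inj₁-injective ∘ ,-injectiveʳ) (Unique.allFin⁺ m)

  hubs-unique : ∀ i → Unique (hubs i)
  hubs-unique i = Unique.map⁺ (inj₂-injective ∘ ,-injectiveʳ) (Unique.allFin⁺ (suc m))

  hub∷rims-unique : ∀ i z j → Unique (hub i z ∷ rims j)
  hub∷rims-unique i z j = All.map⁺ (All.universal (λ _ ()) (allFin m)) ∷ rims-unique j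

  outNeighbours inNeighbours : V → List V
  outNeighbours (rim i _) = hubs i
  outNeighbours (hub i z) = hub i (next z) ∷ rims (not i)
  inNeighbours (rim i _) = hubs (not i)
  inNeighbours (hub i z) = hub i (prev z) ∷ rims i

  outNeighbours-unique : ∀ v → Unique (outNeighbours v)
  outNeighbours-unique (rim i _) = hubs-unique i
  outNeighbours-unique (hub i _) = hub∷rims-unique _ _ _

  inNeighbours-unique : ∀ v → Unique (inNeighbours v)
  inNeighbours-unique (rim i _) = hubs-unique (not i)
  inNeighbours-unique (hub i _) = hub∷rims-unique _ _ _

  length-outNeighbours : ∀ v → length (outNeighbours v) ≡ suc m
  length-outNeighbours (rim i _) = length-map-allFin (hub i)
  length-outNeighbours (hub i _) = cong suc (length-map-allFin (rim (not i)))

  length-inNeighbours : ∀ v → length (inNeighbours v) ≡ suc m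
  length-inNeighbours (rim i _) = length-map-allFin (hub (not i))
  length-inNeighbours (hub i _) = cong suc (length-map-allFin (rim i))

  E⇒∈out : ∀ u {v} → E u v → v ∈ outNeighbours u
  E⇒∈out (rim i _) {hub _ w} (refl , _)    = ∈-map⁺ (hub i) (∈-allFin w)
  E⇒∈out (hub _ z) {rim j b} (refl , _)    =
    there (subst (λ i → rim j b ∈ rims i) (sym (not-involutive j)) (∈-map⁺ (rim j) (∈-allFin b)))
  E⇒∈out (hub i _) {hub _ w} (refl , refl) =
    here (cong (hub i) (prev-injective (sym (prev-next (prev w)))))

  ∈out⇒E : ∀ u {v} → v ∈ outNeighbours u → E u v
  ∈out⇒E (rim i _) v∈ with _ , _ , refl ← ∈-map⁻ (hub i) v∈ = refl , tt
  ∈out⇒E (hub i z) (here refl) = refl , sym (prev-next z)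
  ∈out⇒E (hub i z) (there v∈) with _ , _ , refl ← ∈-map⁻ (rim (not i)) v∈ =
    sym (not-involutive i) , tt

  E⇒∈in : ∀ v {u} → E u v → u ∈ inNeighbours v
  E⇒∈in (rim i _) {hub _ z} (refl , _)    = ∈-map⁺ (hub (not i)) (∈-allFin z)
  E⇒∈in (hub i _) {rim _ b} (refl , _)    = there (∈-map⁺ (rim i) (∈-allFin b))
  E⇒∈in (hub _ _) {hub _ _} (refl , refl) = here refl

  ∈in⇒E : ∀ v {u} → u ∈ inNeighbours v → E u v
  ∈in⇒E (rim i _) u∈ with _ , _ , refl ← ∈-map⁻ (hub (not i)) u∈ = refl , tt
  ∈in⇒E (hub i z) (here refl) = refl , refl
  ∈in⇒E (hub i z) (there u∈) with _ , _ , refl ← ∈-map⁻ (rim i) u∈ = refl , tt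

  outDegree≡ : ∀ v → Digraph.outDegree G v ≡ suc m
  outDegree≡ v = trans
    (length-filter-allFin iso (E? (to v)) (outNeighbours-unique (to v))
      (E⇒∈out (to v)) (∈out⇒E (to v)))
    (length-outNeighbours (to v))

  inDegree≡ : ∀ v → Digraph.inDegree G v ≡ suc m
  inDegree≡ v = trans
    (length-filter-allFin iso (λ u → E? u (to v)) (inNeighbours-unique (to v))
      (E⇒∈in (to v)) (∈in⇒E (to v)))
    (length-inNeighbours (to v))

  δ⁰≡ : δ⁰ G ≡ suc m
  δ⁰≡ = regular⇒δ⁰ G (from (hub true zero)) inDegree≡ outDegree≡

  δ̄⁰≡ : δ̄⁰ G ≡ suc m
  δ̄⁰≡ = regular⇒δ̄⁰ G (from (hub true zero)) inDegree≡ outDegree≡ λ ()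

  -- Opposite edges between a rim and a hub would force a block index to equal its negation. Inside
  -- a hub block, `2 ≤ m` gives the directed cycle at least three vertices.
  E-asym : 2 ≤ m → ∀ {u v} → E u v → ¬ E v u
  E-asym _ {rim _ _} {hub _ _} (refl , _) (eq , _) = not-¬ refl eq
  E-asym _ {hub _ _} {rim _ _} (refl , _) (eq , _) = not-¬ refl eq
  E-asym (s≤s (s≤s _)) {hub _ _} {hub _ _} (_ , refl) (_ , eq) = prev-prev≢ _ (sym eq)

  G-oriented : 2 ≤ m → IsOriented G
  G-oriented 2≤m = record
    { loopless  = λ { refl e → E-asym 2≤m e e }
    ; no2Cycles = E-asym 2≤m
    }

  -- All vertices of an antiwalk have the same component.
  component : Bool × V → Bool
  component (true  , v) = src v
  component (false , v) = tgt v

  step-component : ∀ {p q} → Step E p q → component p ≡ component q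
  step-component (forward (eq , _))  = eq
  step-component (backward (eq , _)) = sym eq

  -- Counting hubs and rims along an antiwalk

  data Hub : Bool × V → Set where
    isHub : ∀ {s i z} → Hub (s , hub i z)

  -- Rims are counted by sign: within component c, the sources lie in the rim block c and the sinks
  -- in the block `not c`. Hubs of either sign lie in the hub block c, so `Hub` ignores the sign.
  data Rim (s : Bool) : Bool × V → Set where
    isRim : ∀ {i a} → Rim s (s , rim i a)

  hub? : U.Decidable Hub
  hub? (_ , rim _ _) = no λ ()
  hub? (_ , hub _ _) = yes isHub

  rim? : ∀ s → U.Decidable (Rim s)
  rim? true  (true  , rim _ _) = yes isRim
  rim? false (false , rim _ _) = yes isRim
  rim? true  (false , rim _ _) = no λ ()
  rim? false (true  , rim _ _) = no λ ()
  rim? true  (_ , hub _ _)     = no λ ()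
  rim? false (_ , hub _ _)     = no λ ()

  #hub : List (Bool × V) → ℕ
  #hub ps = length (filter hub? ps)

  #rim : Bool → List (Bool × V) → ℕ
  #rim s ps = length (filter (rim? s) ps)

  -- Cut the walk into consecutive pairs: no step joins two rims, so each pair contains a hub.
  half≤#hub : ∀ j {ps} → Linked (Step E) ps → length ps ≡ j * 2 → j ≤ #hub ps
  half≤#hub zero _ _ = z≤n
  half≤#hub (suc j) {(_ , rim _ _) ∷ (_ , rim _ _) ∷ _} (forward (_ , ()) ∷ _) _
  half≤#hub (suc j) {(_ , rim _ _) ∷ (_ , rim _ _) ∷ _} (backward (_ , ()) ∷ _) _
  half≤#hub (suc j) {(_ , rim _ _) ∷ (_ , hub _ _) ∷ _} (_ ∷ l) eq =
    s≤s (half≤#hub j (Linked.tail l) (ℕ.suc-injective (ℕ.suc-injective eq)))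
  half≤#hub (suc j) {(_ , hub _ _) ∷ (_ , rim _ _) ∷ _} (_ ∷ l) eq =
    s≤s (half≤#hub j (Linked.tail l) (ℕ.suc-injective (ℕ.suc-injective eq)))
  half≤#hub (suc j) {(_ , hub _ _) ∷ (_ , hub _ _) ∷ _} (_ ∷ l) eq =
    s≤s (ℕ.m≤n⇒m≤1+n (half≤#hub j (Linked.tail l) (ℕ.suc-injective (ℕ.suc-injective eq))))

  -- If the second vertex is a hub, these two and half of the rest are hubs. If it is a rim, the
  -- third vertex is again a hub of sign `s`; the first two vertices add one to both counts and the
  -- argument recurs on the rest.
  manyHubs⊎manyRims : ∀ j {s i z ps} → Linked (Step E) ((s , hub i z) ∷ ps) →
    length ps ≡ suc (j * 2) →
    2 + j ≤ #hub ((s , hub i z) ∷ ps) ⊎ 1 + j ≤ #rim (not s) ((s , hub i z) ∷ ps)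
  manyHubs⊎manyRims j {ps = (_ , hub _ _) ∷ _} (_ ∷ l) eq =
    inj₁ (s≤s (s≤s (half≤#hub j (Linked.tail l) (ℕ.suc-injective eq))))
  -- Matching on the direction of the step fixes `s`, so that `rim? (not s)` computes.
  manyHubs⊎manyRims zero {ps = (_ , rim _ _) ∷ []} (forward _ ∷ _)  _ = inj₂ (s≤s z≤n)
  manyHubs⊎manyRims zero {ps = (_ , rim _ _) ∷ []} (backward _ ∷ _) _ = inj₂ (s≤s z≤n)
  manyHubs⊎manyRims (suc j) {ps = (_ , rim _ _) ∷ (_ , rim _ _) ∷ _} (_ ∷ forward (_ , ()) ∷ _)
  manyHubs⊎manyRims (suc j) {ps = (_ , rim _ _) ∷ (_ , rim _ _) ∷ _} (_ ∷ backward (_ , ()) ∷ _)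
  manyHubs⊎manyRims (suc j) {ps = (_ , rim _ _) ∷ (_ , hub _ _) ∷ _}
    (forward _ ∷ backward _ ∷ l) eq =
    Sum.map s≤s s≤s (manyHubs⊎manyRims j l (ℕ.suc-injective (ℕ.suc-injective eq)))
  manyHubs⊎manyRims (suc j) {ps = (_ , rim _ _) ∷ (_ , hub _ _) ∷ _}
    (backward _ ∷ forward _ ∷ l) eq =
    Sum.map s≤s s≤s (manyHubs⊎manyRims j l (ℕ.suc-injective (ℕ.suc-injective eq)))

  hub∈hubs : ∀ {p c} → Hub p → component p ≡ c → proj₂ p ∈ hubs c
  hub∈hubs {true  , _} isHub refl = ∈-map⁺ (hub _) (∈-allFin _)
  hub∈hubs {false , _} isHub refl = ∈-map⁺ (hub _) (∈-allFin _)

  rimBlock : Bool → Bool → Bool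
  rimBlock true  c = c
  rimBlock false c = not c

  rim∈rims : ∀ {s p c} → Rim s p → component p ≡ c → proj₂ p ∈ rims (rimBlock s c)
  rim∈rims {true}  isRim refl = ∈-map⁺ (rim _) (∈-allFin _)
  rim∈rims {false} (isRim {i} {a}) refl =
    subst (λ j → rim i a ∈ rims j) (sym (not-involutive i)) (∈-map⁺ (rim i) (∈-allFin a))

  -- Supplies the upper bounds that clash with `manyHubs⊎manyRims`: `vs` will be a hub block, with
  -- `suc m` vertices, or a rim block, with `m` vertices.
  selected≤ : ∀ {P : Bool × V → Set} (P? : U.Decidable P) {c ps vs} →
    AllPairs (_≢_ on proj₂) ps → All (λ p → component p ≡ c) ps →
    (∀ {p} → P p → component p ≡ c → proj₂ p ∈ vs) →
    length (filter P? ps) ≤ length vs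
  selected≤ P? {ps = ps} {vs} u cs P⇒∈ = subst (_≤ length vs) (length-map proj₂ (filter P? ps))
    (unique-⊆⇒length≤ (AllPairs.map⁺ (AllPairs.filter⁺ P? u)) inclusion)
    where
    inclusion : map proj₂ (filter P? ps) ⊆ vs
    inclusion v∈ with ∈-map⁻ proj₂ v∈
    ... | p , p∈ , refl with ∈-filter⁻ P? {xs = ps} p∈
    ... | p∈ps , Pp = P⇒∈ Pp (All.lookup cs p∈ps)

  starts-at-rim : (h : Fin (suc m * 2) → Bool × V) →
    (∀ i → Step E (h (inject₁ i)) (h (suc i))) → Injective _≡_ _≡_ (proj₂ ∘ h) →
    ¬ Hub (h zero)
  -- Facts about `tabulate h` mention `h zero`, while the counts need its explicit hub form; `eq`
  -- mediates between the two.
  starts-at-rim h h-step h-inj hub₀ with h zero in eq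
  starts-at-rim h h-step h-inj isHub | s , hub i z = [ tooManyHubs , tooManyRims ]′
      (manyHubs⊎manyRims m (subst (λ p → Linked (Step E) (p ∷ tabulate (h ∘ suc))) eq linked)
        (length-tabulate (h ∘ suc)))
    where
    linked : Linked (Step E) (tabulate h)
    linked = linked-tabulate h h-step

    distinct : AllPairs (_≢_ on proj₂) (tabulate h)
    distinct = AllPairs.tabulate⁺ {f = h} (λ i≢j eq → i≢j (h-inj eq))

    c : Bool
    c = component (h zero)

    components : All (λ p → component p ≡ c) (tabulate h)
    -- The step equations are reversed so that transitivity compares every vertex with the first
    -- one.
    components = Linked⇒All (λ p≡q q≡r → trans q≡r p≡q) {v = h zero} refl
      (Linked.map (sym ∘ step-component) linked)

    tooManyHubs : ¬ 2 + m ≤ #hub ((s , hub i z) ∷ tabulate (h ∘ suc))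
    tooManyHubs le = 1+n≰n (≤-trans
      (subst (λ p → 2 + m ≤ #hub (p ∷ tabulate (h ∘ suc))) (sym eq) le)
      (≤-trans (selected≤ hub? distinct components hub∈hubs)
               (≤-reflexive (length-map-allFin (hub c)))))

    tooManyRims : ¬ 1 + m ≤ #rim (not s) ((s , hub i z) ∷ tabulate (h ∘ suc))
    tooManyRims le = 1+n≰n (≤-trans
      (subst (λ p → 1 + m ≤ #rim (not s) (p ∷ tabulate (h ∘ suc))) (sym eq) le)
      (≤-trans (selected≤ (rim? (not s)) distinct components rim∈rims)
               (≤-reflexive (length-map-allFin (rim (rimBlock (not s) c))))))

  step-meets-hub : ∀ {p q} → Step E p q → ¬ (¬ Hub p × ¬ Hub q)
  step-meets-hub {_ , hub _ _}               _              (p∉ , _) = p∉ isHub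
  step-meets-hub {_ , rim _ _} {_ , hub _ _} _              (_ , q∉) = q∉ isHub
  step-meets-hub {_ , rim _ _} {_ , rim _ _} (forward (_ , ()))  _
  step-meets-hub {_ , rim _ _} {_ , rim _ _} (backward (_ , ())) _

  noAntiwalk : ¬ Antiwalk E (suc m * 2)
  -- Dropping the last or the first position leaves 2k distinct vertices, even when the walk is
  -- closed. Hence neither of the first two vertices is a hub, yet they are joined by a step.
  noAntiwalk w = step-meets-hub (step zero)
    ( starts-at-rim (walk ∘ inject₁) (step ∘ inject₁) initInjective
    , starts-at-rim (walk ∘ suc) (step ∘ suc) tailInjective )
    where open Antiwalk w

  G-noAntiwalk : ¬ Antiwalk (Digraph._⟶_ G) (suc m * 2)
  G-noAntiwalk = noAntiwalk ∘ Antiwalk-map (to-injective iso) (λ e → e)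

proposition1p4 : (k : ℕ) → k ≥ 1 →
    ∃[ n ] Σ[ G ∈ Digraph n ]
    IsOriented G
    × δ⁰ G ≡ k
    × δ̄⁰ G ≡ k
    × ¬ ContainsAntipath G (2 * k)
    × ¬ ContainsAnticycle G (2 * k)
proposition1p4 1 _ =
  3 , C₃ , C₃-oriented , refl , refl , C₃-noAntipath ,
  -- Length 2 is below the minimum length of an anticycle.
  λ { (_ , isC , _) → ℕ.<⇒≱ (s≤s (s≤s (s≤s z≤n))) (IsAnticycle.3≤ℓ isC) }
proposition1p4 2 _ =
  5 , C₅ , C₅-oriented , refl , refl ,
  C₅-noAntiwalk ∘ antipath⇒antiwalk C₅ , C₅-noAntiwalk ∘ anticycle⇒antiwalk C₅
proposition1p4 k@(suc m@(suc (suc _))) _ =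
  order , G , G-oriented (s≤s (s≤s z≤n)) , δ⁰≡ , δ̄⁰≡ ,
  -- `k * 2` unfolds two successors at a time, matching the recursions over pairs of vertices.
  G-noAntiwalk ∘ antipath⇒antiwalk G ∘ subst (ContainsAntipath G) (*-comm 2 k) ,
  G-noAntiwalk ∘ anticycle⇒antiwalk G ∘ subst (ContainsAnticycle G) (*-comm 2 k)
  where open Blowup m
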